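{- Let $n\geq 2$ be an integer and let $k>2$ be an odd integer. Then $P_k^{r,r+1}(n-1)$ is Eulerian for every $r\in\mathbb{Z}$ satisfying $n\leq r<(k-1)n$.
   Context: A $k$-ary $n$-tuple is an element of $\mathbb{Z}_k^n$, with entries identified with the integers $0,1,\dots,k-1$. The de Bruijn digraph $B_k(n-1)$ has vertex set $\mathbb{Z}_k^{n-1}$, and its edges are identified with the $k$-ary $n$-tuples: the $n$-tuple $(x_0,\dots,x_{n-1})$ is the edge from vertex $(x_0,\dots,x_{n-2})$ to vertex $(x_1,\dots,x_{n-1})$ (loops allowed). A subgraph "consisting of" a set of edges has exactly those edges, and its vertices are the vertices incident with at least one of them. A digraph is Eulerian if it is strongly connected (there is a directed path between any ordered pair of its vertices) and balanced (every vertex has in-degree equal to out-degree). Define $f:\mathbb{Z}_k\to\mathbb{Q}$ by $f(a)=a$ (as an integer in $[0,k-1]$) if $a\neq 0$, and $f(0)=k/2$. The pseudoweight of a $k$-ary $n$-tuple $\mathbf{a}=(a_0,\dots,a_{n-1})$ is $w_p(\mathbf{a})=\sum_{i=0}^{n-1}f(a_i)$, computed in $\mathbb{Q}$ (so for odd $k$ it may be a half-integer). For $0\leq r\leq s\leq (k-1)n$, $P_k^{r,s}(n-1)$ is the subgraph of $B_k(n-1)$ consisting of the edges corresponding to $n$-tuples $\mathbf{a}$ with $r\leq w_p(\mathbf{a})\leq s$. -}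

module Defs where

open import Data.Fin using (Fin; zero; suc; toℕ)
import Data.Fin.Properties as Fin
open import Data.Integer using (ℤ; +_)
open import Data.List as List using (List; []; _∷_; length; filter; allFin; cartesianProductWith)
open import Data.List.Membership.Propositional using (_∈_)
open import Data.List.Membership.Propositional.Properties
  using (∈-allFin; ∈-cartesianProductWith⁺)
open import Data.List.Relation.Unary.Any using (here)
open import Data.List.Relation.Unary.All using ([])
open import Data.List.Relation.Unary.AllPairs using ([]; _∷_)
open import Data.List.Relation.Unary.Unique.Propositional using (Unique)
import Data.List.Relation.Unary.Unique.Propositional.Properties as Unique
open import Data.Nat using (ℕ; zero; suc)
open import Data.Product using (_×_; _,_; ∃-syntax)
open import Data.Rational as ℚ using (ℚ; 0ℚ; _/_)
import Data.Rational.Properties as ℚ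
open import Data.Sum using (_⊎_; inj₁; inj₂)
open import Data.Unit using (⊤; tt)
open import Data.Vec as Vec using (Vec; []; _∷_; init; tail; foldr′)
import Data.Vec.Properties as Vec
open import Relation.Binary.Construct.Closure.ReflexiveTransitive using (Star)
open import Relation.Binary.Definitions using (DecidableEquality)
open import Relation.Binary.PropositionalEquality using (_≡_; refl)
open import Relation.Nullary.Decidable using (_×-dec_)
open import Relation.Unary using (Pred; Decidable)
open import Level using (0ℓ)

-- A digraph with finitely many edges.  The vertices are the elements of the
-- ambient type V satisfying IsVertex; the edges are the members of the
-- duplicate-free list `edges`.  Keeping V and E ambient lets a subgraph share
-- them with the graph it lives in.
record Digraph : Set₁ where
  field
    V        : Set
    E        : Set
    _≟_      : DecidableEquality V
    source   : E → V
    target   : E → V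
    IsVertex : Pred V 0ℓ
    edges    : List E
    unique   : Unique edges
    source-isVertex : ∀ {e} → e ∈ edges → IsVertex (source e)
    target-isVertex : ∀ {e} → e ∈ edges → IsVertex (target e)

  outdegree : V → ℕ
  outdegree v = length (filter (λ e → source e ≟ v) edges)

  indegree : V → ℕ
  indegree v = length (filter (λ e → target e ≟ v) edges)

  _⟶_ : V → V → Set
  u ⟶ v = ∃[ e ] (e ∈ edges × source e ≡ u × target e ≡ v)

  -- Star allows the trivial path from a vertex to itself.
  StronglyConnected : Set
  StronglyConnected = ∀ {u v} → IsVertex u → IsVertex v → Star _⟶_ u v

  Balanced : Set
  Balanced = ∀ {v} → IsVertex v → indegree v ≡ outdegree v

  Eulerian : Set
  Eulerian = StronglyConnected × Balanced

-- The subgraph consisting of the edges of G that satisfy P; its vertices are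
-- exactly those incident with such an edge.
consistingOf : (G : Digraph) {P : Pred (Digraph.E G) 0ℓ} → Decidable P → Digraph
consistingOf G P? = record
  { V = V ; E = E ; _≟_ = _≟_ ; source = source ; target = target
  ; IsVertex = λ v → ∃[ e ] (e ∈ filter P? edges × (source e ≡ v ⊎ target e ≡ v))
  ; edges = filter P? edges
  ; unique = Unique.filter⁺ P? unique
  ; source-isVertex = λ e∈ → _ , e∈ , inj₁ refl
  ; target-isVertex = λ e∈ → _ , e∈ , inj₂ refl
  }
  where open Digraph G

-- ℤ_k is represented by Fin k: only the identification of its elements with
-- 0, …, k - 1 is used, never its addition.
Tuple : ℕ → ℕ → Set
Tuple k n = Vec (Fin k) n

allTuples : ∀ k n → List (Tuple k n)
allTuples k zero    = [] ∷ []
allTuples k (suc n) = cartesianProductWith _∷_ (allFin k) (allTuples k n)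

allTuples-unique : ∀ k n → Unique (allTuples k n)
allTuples-unique k zero    = [] ∷ []
allTuples-unique k (suc n) =
  Unique.cartesianProductWith⁺ _∷_ Vec.∷-injective (Unique.allFin⁺ k) (allTuples-unique k n)

allTuples-complete : ∀ {k n} (a : Tuple k n) → a ∈ allTuples k n
allTuples-complete []      = here refl
allTuples-complete (x ∷ a) = ∈-cartesianProductWith⁺ _∷_ (∈-allFin x) (allTuples-complete a)

-- The argument m is the length of the vertex tuples; edges have length m + 1.
B : (k m : ℕ) → Digraph
B k m = record
  { V = Tuple k m ; E = Tuple k (suc m) ; _≟_ = Vec.≡-dec Fin._≟_
  ; source = init ; target = tail
  ; IsVertex = λ _ → ⊤
  ; edges = allTuples k (suc m)
  ; unique = allTuples-unique k (suc m)
  ; source-isVertex = λ _ → tt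
  ; target-isVertex = λ _ → tt
  }

f : ∀ {k} → Fin k → ℚ
f {k} zero    = + k / 2
f     (suc i) = + toℕ (suc i) / 1

pseudoweight : ∀ {k n} → Tuple k n → ℚ
pseudoweight a = foldr′ ℚ._+_ 0ℚ (Vec.map f a)

PseudoweightIn : ∀ {k n} → ℤ → ℤ → Pred (Tuple k n) 0ℓ
PseudoweightIn r s a = r / 1 ℚ.≤ pseudoweight a × pseudoweight a ℚ.≤ s / 1

pseudoweightIn? : ∀ {k n} (r s : ℤ) → Decidable (PseudoweightIn {k} {n} r s)
pseudoweightIn? r s a = (r / 1 ℚ.≤? pseudoweight a) ×-dec (pseudoweight a ℚ.≤? s / 1)

-- As for B, the argument m is one less than the length of the edge tuples.
P : (k : ℕ) (r s : ℤ) (m : ℕ) → Digraph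
P k r s m = consistingOf (B k m) (pseudoweightIn? r s)

{-# OPTIONS --safe #-}

-- The tuples x ∷ v and v ∷ʳ x have the same pseudoweight, so rotation is a
-- bijection between the edges into v and the edges out of v; hence the graph is
-- balanced, and every vertex is the source of an edge.
--
-- For strong connectivity, shift the letters of an edge b into an edge a, one
-- at a time.  If a and b differ in a single entry, every tuple met on the way
-- has the weight of a or that of b, so this is a path of the graph.  It remains
-- to connect any two admissible tuples by admissible changes of single entries.
-- A zero can be replaced by ⌊k/2⌋ or ⌈k/2⌉, changing the weight by at most 1/2 in
-- a direction of our choice, so we may assume both tuples zero-free.  Their
-- weights are then integers in {r , r+1}.  Say w(a) ≤ w(b) and a ≠ b, so that
-- aᵢ < bᵢ for some i: if w(a) = r then aᵢ can be raised by 1, and otherwise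
-- w(b) = r+1 and bᵢ can be lowered by 1, which brings a and b closer together.
module Submission where

open import Defs
open import Data.Fin as Fin using (Fin; zero; suc; toℕ; fromℕ<; inject₁)
import Data.Fin.Properties as Fin
open import Data.Integer as ℤ using (ℤ; +_; 1ℤ)
import Data.Integer.Properties as ℤ
open import Data.List as List using (List; []; _∷_; _++_; [_]; filter)
import Data.List.Properties as List
open import Data.List.Membership.Propositional using (_∈_)
open import Data.List.Membership.Propositional.Properties
  using (∈-filter⁺; ∈-filter⁻; ∈-map⁺; ∈-map⁻)
open import Data.List.Membership.Propositional.Properties.WithK using (unique∧set⇒bag)
open import Data.List.Relation.Binary.BagAndSetEquality using (∼bag⇒↭)
open import Data.List.Relation.Binary.Permutation.Propositional.Properties using (↭-length)
open import Data.List.Relation.Unary.Unique.Propositional using (Unique)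
import Data.List.Relation.Unary.Unique.Propositional.Properties as Unique
open import Data.Nat hiding (_≟_)
open import Data.Nat.Divisibility using (_∣_)
open import Data.Nat.ListAction using (sum)
open import Data.Nat.ListAction.Properties using (sum-++)
open import Data.Nat.Properties hiding (_≟_)
open import Data.Nat.Tactic.RingSolver using (solve-∀)
open import Data.Product using (_×_; _,_; ∃-syntax; proj₂)
open import Data.Rational as ℚ using (toℚᵘ)
import Data.Rational.Properties as ℚ
open import Data.Rational.Unnormalised as ℚᵘ using (mkℚᵘ; *≤*; *≡*)
import Data.Rational.Unnormalised.Properties as ℚᵘ
open import Data.Sum using (_⊎_; inj₁; inj₂)
open import Data.Vec as Vec using (Vec; []; _∷_; _∷ʳ_; init; tail; toList)
import Data.Vec.Properties as Vec
open import Function using (_∘_; mk⇔; _⇔_; Equivalence)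
open import Relation.Binary using (Rel; Symmetric)
open import Relation.Binary.Construct.Closure.ReflexiveTransitive as Star
  using (Star; ε; _◅_; _◅◅_; gmap; kleisliStar)
open import Relation.Binary.PropositionalEquality hiding ([_])
open import Relation.Nullary using (¬_; yes; no)
open import Relation.Unary using (Decidable; Pred)
open import Level using (0ℓ)

private variable
  A C : Set
  k l p : ℕ

-- Rotation of tuples

toList-injective : (xs ys : Vec A p) → toList xs ≡ toList ys → xs ≡ ys
toList-injective xs ys eq =
  trans (sym (Vec.cast-is-id refl xs)) (Vec.toList-injective refl xs ys eq)

rotate : Vec A (suc p) → Vec A (suc p)
rotate (x ∷ v) = v ∷ʳ x

rotate-injective : {a b : Vec A (suc p)} → rotate a ≡ rotate b → a ≡ b
rotate-injective {a = _ ∷ v} {_ ∷ w} eq =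
  let v≡w , x≡y = Vec.∷ʳ-injective v w eq in cong₂ _∷_ x≡y v≡w

init-rotate : (a : Vec A (suc p)) → init (rotate a) ≡ tail a
init-rotate (x ∷ v) = Vec.init-∷ʳ x v

unrotate : (a : Vec A (suc p)) → ∃[ b ] (rotate b ≡ a × tail b ≡ init a)
unrotate a = Vec.last a ∷ init a , sym (proj₂ (proj₂ (Vec.initLast a))) , refl

-- Pseudoweights as doubled integers

-- Doubled contributions f, which are integers.
doubled : Fin k → ℕ
doubled {k} zero = k
doubled (suc i)  = suc (toℕ i) * 2

weight : List (Fin k) → ℕ
weight = sum ∘ List.map doubled

weight-++ : (xs ys : List (Fin k)) → weight (xs ++ ys) ≡ weight xs + weight ys
weight-++ xs ys = trans (cong sum (List.map-++ doubled xs ys)) (sum-++ (List.map doubled xs) _)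

weight-++-comm : (xs ys : List (Fin k)) → weight (xs ++ ys) ≡ weight (ys ++ xs)
weight-++-comm xs ys =
  trans (weight-++ xs ys) (trans (+-comm (weight xs) _) (sym (weight-++ ys xs)))

weight-rotate : (a : Tuple k (suc p)) → weight (toList (rotate a)) ≡ weight (toList a)
weight-rotate (x ∷ v) =
  trans (cong weight (Vec.toList-∷ʳ x v)) (weight-++-comm (toList v) [ x ])

-- `mkℚᵘ` stores the denominator minus one, so `mkℚᵘ (+ s) 1` stands for `s / 2`.
toℚᵘ-f : (i : Fin k) → toℚᵘ (f i) ℚᵘ.≃ mkℚᵘ (+ doubled i) 1
toℚᵘ-f {k} zero = ℚ.toℚᵘ-fromℚᵘ (mkℚᵘ (+ k) 1)
toℚᵘ-f (suc i)  = ℚᵘ.≃-trans (ℚ.toℚᵘ-fromℚᵘ (mkℚᵘ (+ suc (toℕ i)) 0))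
  (*≡* (trans (sym (ℤ.pos-* (suc (toℕ i)) 2)) (sym (ℤ.*-identityʳ _))))

toℚᵘ-pseudoweight : (a : Tuple k p) → toℚᵘ (pseudoweight a) ℚᵘ.≃ mkℚᵘ (+ weight (toList a)) 1
toℚᵘ-pseudoweight []      = *≡* refl
toℚᵘ-pseudoweight (x ∷ a) =
  ℚᵘ.≃-trans (ℚ.toℚᵘ-homo-+ (f x) (pseudoweight a))
    (ℚᵘ.≃-trans (ℚᵘ.+-cong (toℚᵘ-f x) (toℚᵘ-pseudoweight a)) (halves (doubled x) _))
  where
  distrib : ∀ s t → (s * 2 + t * 2) * 2 ≡ (s + t) * 4
  distrib = solve-∀

  halves : ∀ s t → mkℚᵘ (+ s) 1 ℚᵘ.+ mkℚᵘ (+ t) 1 ℚᵘ.≃ mkℚᵘ (+ (s + t)) 1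
  halves s t = *≡* (begin
    (+ s ℤ.* + 2 ℤ.+ + t ℤ.* + 2) ℤ.* + 2
      ≡⟨ cong (ℤ._* + 2) (cong₂ ℤ._+_ (sym (ℤ.pos-* s 2)) (sym (ℤ.pos-* t 2))) ⟩
    (+ (s * 2 + t * 2)) ℤ.* + 2  ≡⟨ sym (ℤ.pos-* (s * 2 + t * 2) 2) ⟩
    + ((s * 2 + t * 2) * 2)      ≡⟨ cong +_ (distrib s t) ⟩
    + ((s + t) * 4)              ≡⟨ ℤ.pos-* (s + t) 4 ⟩
    + (s + t) ℤ.* + 4            ∎)
    where open ≡-Reasoning

-- The bounds `r` and `r + 1` on a pseudoweight, expressed for its double `s`.
Window : ℕ → ℕ → Set
Window r s = r * 2 ≤ s × s ≤ suc r * 2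

integer≤half : ∀ t s → mkℚᵘ (+ t) 0 ℚᵘ.≤ mkℚᵘ (+ s) 1 ⇔ t * 2 ≤ s
integer≤half t s = mk⇔
  (λ { (*≤* le) → ℤ.drop‿+≤+ (subst₂ ℤ._≤_ (sym (ℤ.pos-* t 2)) (ℤ.*-identityʳ _) le) })
  (λ le → *≤* (subst₂ ℤ._≤_ (ℤ.pos-* t 2) (sym (ℤ.*-identityʳ _)) (ℤ.+≤+ le)))

half≤integer : ∀ t s → mkℚᵘ (+ s) 1 ℚᵘ.≤ mkℚᵘ (+ t) 0 ⇔ s ≤ t * 2
half≤integer t s = mk⇔
  (λ { (*≤* le) → ℤ.drop‿+≤+ (subst₂ ℤ._≤_ (ℤ.*-identityʳ _) (sym (ℤ.pos-* t 2)) le) })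
  (λ le → *≤* (subst₂ ℤ._≤_ (sym (ℤ.*-identityʳ _)) (ℤ.pos-* t 2) (ℤ.+≤+ le)))

module _ (r : ℕ) (a : Tuple k p) where
  private w = weight (toList a)

  open Equivalence

  pseudoweightIn⇒window : PseudoweightIn (+ r) (+ suc r) a → Window r w
  pseudoweightIn⇒window (lo , hi) =
    to (integer≤half r w)
      (ℚᵘ.≤-respˡ-≃ (ℚ.toℚᵘ-fromℚᵘ (mkℚᵘ (+ r) 0))
        (ℚᵘ.≤-respʳ-≃ (toℚᵘ-pseudoweight a) (ℚ.toℚᵘ-mono-≤ lo))) ,
    to (half≤integer (suc r) w)
      (ℚᵘ.≤-respʳ-≃ (ℚ.toℚᵘ-fromℚᵘ (mkℚᵘ (+ suc r) 0))
        (ℚᵘ.≤-respˡ-≃ (toℚᵘ-pseudoweight a) (ℚ.toℚᵘ-mono-≤ hi)))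

  window⇒pseudoweightIn : Window r w → PseudoweightIn (+ r) (+ suc r) a
  window⇒pseudoweightIn (lo , hi) =
    ℚ.toℚᵘ-cancel-≤
      (ℚᵘ.≤-respˡ-≃ (ℚᵘ.≃-sym (ℚ.toℚᵘ-fromℚᵘ (mkℚᵘ (+ r) 0)))
        (ℚᵘ.≤-respʳ-≃ (ℚᵘ.≃-sym (toℚᵘ-pseudoweight a)) (from (integer≤half r w) lo))) ,
    ℚ.toℚᵘ-cancel-≤
      (ℚᵘ.≤-respʳ-≃ (ℚᵘ.≃-sym (ℚ.toℚᵘ-fromℚᵘ (mkℚᵘ (+ suc r) 0)))
        (ℚᵘ.≤-respˡ-≃ (ℚᵘ.≃-sym (toℚᵘ-pseudoweight a)) (from (half≤integer (suc r) w) hi)))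

-- Paths realising the change of a single entry

-- One position is singled out; the two entries there may coincide.
data _~_ {A : Set} : Vec A p → Vec A p → Set where
  here  : ∀ {x y} {v : Vec A p} → (x ∷ v) ~ (y ∷ v)
  there : ∀ {x} {v w : Vec A p} → v ~ w → (x ∷ v) ~ (x ∷ w)

~-sym : {a b : Vec A p} → a ~ b → b ~ a
~-sym here      = here
~-sym (there s) = there (~-sym s)

~-map : (h : A → C) {a b : Vec A p} → a ~ b → Vec.map h a ~ Vec.map h b
~-map h here      = here
~-map h (there s) = there (~-map h s)

-- Both ends must satisfy `Q`, which makes the relation symmetric and lets chains be reversed.
Step : Pred (Vec A p) 0ℓ → Rel (Vec A p) 0ℓ
Step Q a b = a ~ b × Q a × Q b

Step-sym : {Q : Pred (Vec A p) 0ℓ} → Symmetric (Step Q)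
Step-sym (a~b , qa , qb) = ~-sym a~b , qb , qa

module _ {k m : ℕ} (Q : Pred ℕ 0ℓ) {_⟶_ : Rel (Tuple k m) 0ℓ}
         (edge : ∀ e → Q (weight (toList e)) → init e ⟶ tail e) where

  -- The edge `x ∷ v` ends at `v`, which is the source of `v ∷ʳ y` whatever the new letter `y` is.
  append : ∀ {x : Fin k} {v u} y → Q (weight (toList (x ∷ v))) →
           Star _⟶_ (init (v ∷ʳ y)) u → Star _⟶_ (init (x ∷ v)) u
  append {x} {v} y q path =
    edge (x ∷ v) q ◅ subst (λ z → Star _⟶_ z _) (Vec.init-∷ʳ y v) path

  toList-append : ∀ {v : Tuple k m} xs ys y → toList v ≡ xs ++ ys →
                  toList (v ∷ʳ y) ≡ xs ++ (ys ++ [ y ])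
  toList-append {v} xs ys y eq =
    trans (Vec.toList-∷ʳ y v) (trans (cong (_++ [ y ]) eq) (List.++-assoc xs ys [ y ]))

  -- `xs` holds the letters still to be moved to the end. Every edge used is a rotation of `e`, so
  -- its weight is that of `e`.
  rotation-path : ∀ xs {ys} {e e′ : Tuple k (suc m)} →
    toList e ≡ xs ++ ys → toList e′ ≡ ys ++ xs →
    Q (weight (toList e)) → Star _⟶_ (init e) (init e′)
  rotation-path [] {ys} {e} {e′} eq eq′ q
    with refl ← toList-injective e e′ (trans eq (sym (trans eq′ (List.++-identityʳ ys)))) = ε
  rotation-path (x ∷ xs) {ys} {z ∷ v} eq eq′ q with refl , eqᵥ ← List.∷-injective eq =
    append x q
      (rotation-path xs {ys ++ [ x ]} (toList-append xs ys x eqᵥ)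
        (trans eq′ (sym (List.++-assoc ys [ x ] xs)))
        (subst Q (sym (weight-rotate (x ∷ v))) q))

  -- `ys` holds the letters already shifted in. Up to the changed position the edges used are
  -- rotations of `e`; beyond it they are rotations of `e′`, and `rotation-path` finishes.
  change-path : ∀ {as bs : Tuple k p} {ys} {e e′ : Tuple k (suc m)} → as ~ bs →
    toList e ≡ toList as ++ ys → toList e′ ≡ ys ++ toList bs →
    Q (weight (toList e)) → Q (weight (toList e′)) → Star _⟶_ (init e) (init e′)
  change-path {ys = ys} {z ∷ v} {e′} (here {x = x} {y} {as}) eq eq′ q q′
    with refl , eqᵥ ← List.∷-injective eq =
    append y q (rotation-path (toList as) eq₁ eq₁′
      (subst Q (trans (cong weight eq₁′)
        (trans (weight-++-comm (ys ++ [ y ]) (toList as)) (cong weight (sym eq₁)))) q′))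
    where
    eq₁ : toList (v ∷ʳ y) ≡ toList as ++ (ys ++ [ y ])
    eq₁ = toList-append (toList as) ys y eqᵥ

    eq₁′ : toList e′ ≡ (ys ++ [ y ]) ++ toList as
    eq₁′ = trans eq′ (sym (List.++-assoc ys [ y ] (toList as)))
  change-path {ys = ys} {z ∷ v} (there {x = x} {as} {bs} as~bs) eq eq′ q q′
    with refl , eqᵥ ← List.∷-injective eq =
    append x q
      (change-path as~bs (toList-append (toList as) ys x eqᵥ)
        (trans eq′ (sym (List.++-assoc ys [ x ] (toList bs))))
        (subst Q (sym (weight-rotate (x ∷ v))) q) q′)

  step-path : ∀ {a b : Tuple k (suc m)} → Step (Q ∘ weight ∘ toList) a b → Star _⟶_ (init a) (init b)
  step-path {a} (a~b , qa , qb) = change-path a~b (sym (List.++-identityʳ (toList a))) refl qa qb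

-- Elimination of zeros

-- From every member, one of the two directions allows moves by at most 1.
Roomy : Pred ℕ 0ℓ → Set
Roomy Q = ∀ {s} → Q s → (∀ {t} → s ≤ t → t ≤ suc s → Q t) ⊎ (∀ {t} → t ≤ s → s ≤ suc t → Q t)

-- Once the head of a tuple is fixed, its contribution `c` shifts the condition on the weight of the
-- tail; this allows `eliminate-zeros` to recurse.
roomy-shift : ∀ {Q} c → Roomy Q → Roomy (λ s → Q (c + s))
roomy-shift {Q} c roomy {s} q with roomy q
... | inj₁ up   = inj₁ λ {t} s≤t t≤1+s →
  up (+-monoʳ-≤ c s≤t) (subst (c + t ≤_) (+-suc c s) (+-monoʳ-≤ c t≤1+s))
... | inj₂ down = inj₂ λ {t} t≤s s≤1+t →
  down (+-monoʳ-≤ c t≤s) (subst (c + s ≤_) (+-suc c t) (+-monoʳ-≤ c s≤1+t))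

-- In doubled weights the window has length 2: up to `2r + 1` there is room above, and from `2r + 2`
-- there is room below.
window-roomy : ∀ r → Roomy (Window r)
window-roomy r {s} (lo , hi) with s ≤? suc (r * 2)
... | yes s≤ = inj₁ λ s≤t t≤1+s → ≤-trans lo s≤t , ≤-trans t≤1+s (s≤s s≤)
... | no s≰  = inj₂ λ t≤s s≤1+t → s≤s⁻¹ (≤-trans (<⇒≤ (≰⇒> s≰)) s≤1+t) , ≤-trans t≤s hi

-- By definition the two sides are the rounded-down halves of `suc n` and `suc (suc n)`.
⌈n/2⌉≤1+⌊n/2⌋ : ∀ n → ⌈ n /2⌉ ≤ suc ⌊ n /2⌋
⌈n/2⌉≤1+⌊n/2⌋ n = ⌊n/2⌋-mono (n≤1+n (suc n))

n*2≡n+n : ∀ n → n * 2 ≡ n + n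
n*2≡n+n = solve-∀

module _ (n : ℕ) where
  open ≤-Reasoning

  ⌊n/2⌋*2≤n : ⌊ n /2⌋ * 2 ≤ n
  ⌊n/2⌋*2≤n = begin
    ⌊ n /2⌋ * 2        ≡⟨ n*2≡n+n ⌊ n /2⌋ ⟩
    ⌊ n /2⌋ + ⌊ n /2⌋  ≤⟨ +-monoʳ-≤ ⌊ n /2⌋ (⌊n/2⌋≤⌈n/2⌉ n) ⟩
    ⌊ n /2⌋ + ⌈ n /2⌉  ≡⟨ ⌊n/2⌋+⌈n/2⌉≡n n ⟩
    n                  ∎

  n≤1+⌊n/2⌋*2 : n ≤ suc (⌊ n /2⌋ * 2)
  n≤1+⌊n/2⌋*2 = begin
    n                        ≡⟨ ⌊n/2⌋+⌈n/2⌉≡n n ⟨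
    ⌊ n /2⌋ + ⌈ n /2⌉        ≤⟨ +-monoʳ-≤ ⌊ n /2⌋ (⌈n/2⌉≤1+⌊n/2⌋ n) ⟩
    ⌊ n /2⌋ + suc ⌊ n /2⌋    ≡⟨ +-suc ⌊ n /2⌋ ⌊ n /2⌋ ⟩
    suc (⌊ n /2⌋ + ⌊ n /2⌋)  ≡⟨ cong suc (n*2≡n+n ⌊ n /2⌋) ⟨
    suc (⌊ n /2⌋ * 2)        ∎

  n≤⌈n/2⌉*2 : n ≤ ⌈ n /2⌉ * 2
  n≤⌈n/2⌉*2 = begin
    n                  ≡⟨ ⌊n/2⌋+⌈n/2⌉≡n n ⟨
    ⌊ n /2⌋ + ⌈ n /2⌉  ≤⟨ +-monoˡ-≤ ⌈ n /2⌉ (⌊n/2⌋≤⌈n/2⌉ n) ⟩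
    ⌈ n /2⌉ + ⌈ n /2⌉  ≡⟨ n*2≡n+n ⌈ n /2⌉ ⟨
    ⌈ n /2⌉ * 2        ∎

  ⌈n/2⌉*2≤1+n : ⌈ n /2⌉ * 2 ≤ suc n
  ⌈n/2⌉*2≤1+n = begin
    ⌈ n /2⌉ * 2              ≡⟨ n*2≡n+n ⌈ n /2⌉ ⟩
    ⌈ n /2⌉ + ⌈ n /2⌉        ≤⟨ +-monoˡ-≤ ⌈ n /2⌉ (⌈n/2⌉≤1+⌊n/2⌋ n) ⟩
    suc (⌊ n /2⌋ + ⌈ n /2⌉)  ≡⟨ cong suc (⌊n/2⌋+⌈n/2⌉≡n n) ⟩
    suc n                    ∎

-- The letters suc ⌊half⌋ and suc ⌈half⌉ of Fin (2 + l) are ⌊k/2⌋ and ⌈k/2⌉ for k = 2 + l.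
⌊half⌋ ⌈half⌉ : ∀ l → Fin (suc l)
⌊half⌋ l = fromℕ< (s≤s (⌊n/2⌋≤n l))
⌈half⌉ l = fromℕ< (s≤s (⌈n/2⌉≤n l))

doubled-⌊half⌋ : ∀ l → doubled (suc (⌊half⌋ l)) ≡ ⌊ suc (suc l) /2⌋ * 2
doubled-⌊half⌋ l = cong (λ n → suc n * 2) (Fin.toℕ-fromℕ< (s≤s (⌊n/2⌋≤n l)))

doubled-⌈half⌉ : ∀ l → doubled (suc (⌈half⌉ l)) ≡ ⌈ suc (suc l) /2⌉ * 2
doubled-⌈half⌉ l = cong (λ n → suc n * 2) (Fin.toℕ-fromℕ< (s≤s (⌈n/2⌉≤n l)))

ZeroFreeReachable : Pred ℕ 0ℓ → Tuple (suc l) p → Set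
ZeroFreeReachable Q a =
  ∃[ c ] (Q (weight (toList (Vec.map suc c))) × Star (Step (Q ∘ weight ∘ toList)) a (Vec.map suc c))

eliminate-zeros : ∀ {Q} → Roomy Q → (a : Tuple (suc (suc l)) p) →
                  Q (weight (toList a)) → ZeroFreeReachable Q a
eliminate-zeros roomy [] q = [] , q , ε
eliminate-zeros {l} {Q = Q} roomy (x ∷ a) q = go x q
  where
  nonzero-head : ∀ i → Q (weight (toList (suc i ∷ a))) → ZeroFreeReachable Q (suc i ∷ a)
  nonzero-head i q =
    let c , qc , steps = eliminate-zeros (roomy-shift {Q} (doubled (suc i)) roomy) a q
    in i ∷ c , qc , gmap (suc i ∷_) (λ (s , q , q′) → there s , q , q′) steps

  replace-head : ∀ i → Q (weight (toList (zero ∷ a))) → Q (weight (toList (suc i ∷ a))) →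
                 ZeroFreeReachable Q (zero ∷ a)
  replace-head i q q′ =
    let c , qc , steps = nonzero-head i q′ in c , qc , (here , q , q′) ◅ steps

  go : ∀ x → Q (weight (toList (x ∷ a))) → ZeroFreeReachable Q (x ∷ a)
  go (suc i) q = nonzero-head i q
  go zero    q with roomy q
  ... | inj₁ up   = replace-head (⌈half⌉ l) q (up
    (+-monoˡ-≤ _ (subst (suc (suc l) ≤_) (sym (doubled-⌈half⌉ l)) (n≤⌈n/2⌉*2 (suc (suc l)))))
    (+-monoˡ-≤ _ (subst (_≤ suc (suc (suc l))) (sym (doubled-⌈half⌉ l)) (⌈n/2⌉*2≤1+n (suc (suc l))))))
  ... | inj₂ down = replace-head (⌊half⌋ l) q (down
    (+-monoˡ-≤ _ (subst (_≤ suc (suc l)) (sym (doubled-⌊half⌋ l)) (⌊n/2⌋*2≤n (suc (suc l)))))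
    (+-monoˡ-≤ _ (subst (λ n → suc (suc l) ≤ suc n) (sym (doubled-⌊half⌋ l)) (n≤1+⌊n/2⌋*2 (suc (suc l))))))

-- Connecting zero-free tuples

-- A zero-free tuple is Vec.map suc c; its weight is total c, undoubled.
total : Vec (Fin l) p → ℕ
total []      = 0
total (x ∷ c) = suc (toℕ x) + total c

weight-map-suc : (c : Vec (Fin l) p) → weight (toList (Vec.map suc c)) ≡ total c * 2
weight-map-suc []      = refl
weight-map-suc (x ∷ c) = trans (cong (λ s → suc (toℕ x) * 2 + s) (weight-map-suc c))
  (sym (*-distribʳ-+ 2 (suc (toℕ x)) (total c)))

dist : Vec (Fin l) p → Vec (Fin l) p → ℕ
dist []      []      = 0
dist (x ∷ a) (y ∷ b) = ∣ toℕ x - toℕ y ∣ + dist a b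

dist-comm : (a b : Vec (Fin l) p) → dist a b ≡ dist b a
dist-comm []      []      = refl
dist-comm (x ∷ a) (y ∷ b) = cong₂ _+_ (∣-∣-comm (toℕ x) (toℕ y)) (dist-comm a b)

∣-∣-raise : ∀ {m n} → m < n → ∣ m - n ∣ ≡ suc ∣ suc m - n ∣
∣-∣-raise {zero}  {suc n} _         = refl
∣-∣-raise {suc m} {suc n} (s≤s m<n) = ∣-∣-raise m<n

∣-∣-lower : ∀ {m n} → m ≤ n → ∣ m - suc n ∣ ≡ suc ∣ m - n ∣
∣-∣-lower z≤n       = refl
∣-∣-lower (s≤s m≤n) = ∣-∣-lower m≤n

-- Both moves are kept, because which of them respects the bounds on the total is decided only in
-- `connect-≤`.
record Closer (a b : Vec (Fin l) p) : Set where
  constructor closer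
  field
    {raised lowered} : Vec (Fin l) p
    raise         : a ~ raised
    lower         : lowered ~ b
    raise-total   : total raised ≡ suc (total a)
    lower-total   : total b ≡ suc (total lowered)
    raise-dist    : dist a b ≡ suc (dist raised b)
    lower-dist    : dist a b ≡ suc (dist a lowered)

closer-here : {x y : Fin l} {a b : Vec (Fin l) p} → x Fin.< y → Closer (x ∷ a) (y ∷ b)
closer-here {x = x} {suc y} {a} {b} x<y@(s≤s x≤y) = closer
  {raised  = fromℕ< 1+x<l ∷ a}
  {lowered = inject₁ y ∷ b}
  here here
  (cong (λ n → suc n + total a) toℕ-raised)
  (cong (λ n → suc (suc n) + total b) (sym toℕ-lowered))
  (trans (cong (_+ dist a b) (∣-∣-raise x<y))
    (cong (λ n → suc (∣ n - suc (toℕ y) ∣ + dist a b)) (sym toℕ-raised)))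
  (trans (cong (_+ dist a b) (∣-∣-lower x≤y))
    (cong (λ n → suc (∣ toℕ x - n ∣ + dist a b)) (sym toℕ-lowered)))
  where
  -- The raised letter is at most the letter facing it, so it stays below `l`.
  1+x<l = ≤-<-trans x<y (Fin.toℕ<n (suc y))
  toℕ-raised = Fin.toℕ-fromℕ< 1+x<l
  toℕ-lowered = Fin.toℕ-inject₁ y

closer-there : ∀ {x y : Fin l} {a b : Vec (Fin l) p} → Closer a b → Closer (x ∷ a) (y ∷ b)
closer-there {x = x} {y} (closer raise lower ta tb da db) = closer
  (there raise) (there lower)
  (suc-inside (suc (toℕ x)) ta) (suc-inside (suc (toℕ y)) tb)
  (suc-inside ∣ toℕ x - toℕ y ∣ da) (suc-inside ∣ toℕ x - toℕ y ∣ db)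
  where
  suc-inside : ∀ c {s t} → s ≡ suc t → c + s ≡ suc (c + t)
  suc-inside c refl = +-suc c _

-- If the heads satisfy `y ≤ x`, the inequality of totals passes to the tails. If the tails then
-- agree, it also forces `x ≤ y`.
approach : (a b : Vec (Fin l) p) → total a ≤ total b → a ≡ b ⊎ Closer a b
approach []      []      _  = inj₁ refl
approach (x ∷ a) (y ∷ b) le with toℕ x <? toℕ y
... | yes x<y = inj₂ (closer-here x<y)
... | no  x≮y with approach a b (+-cancelˡ-≤ (suc (toℕ y)) _ _
                     (≤-trans (+-monoˡ-≤ (total a) (s≤s (≮⇒≥ x≮y))) le))
...   | inj₂ c    = inj₂ (closer-there c)
...   | inj₁ refl = inj₁ (cong (_∷ a) (Fin.toℕ-injective
                      (≤-antisym (s≤s⁻¹ (+-cancelʳ-≤ (total a) _ _ le)) (≮⇒≥ x≮y))))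

NarrowTotal : ℕ → Pred (Vec (Fin l) p) 0ℓ
NarrowTotal r c = r ≤ total c × total c ≤ suc r

mutual
  -- Induction on the distance. Raising `a` or lowering `b` can reverse the order of the totals, so
  -- the recursion passes through `connect`, which swaps the two ends if necessary.
  connect-≤ : ∀ {r} N (a b : Vec (Fin l) p) → dist a b ≡ N → total a ≤ total b →
              NarrowTotal r a → NarrowTotal r b → Star (Step (NarrowTotal r)) a b
  connect-≤ {r = r} N a b d a≤b qa qb with approach a b a≤b
  ... | inj₁ refl = ε
  connect-≤ zero a b d a≤b qa qb
    | inj₂ (closer _ _ _ _ da _) with () ← trans (sym d) da
  connect-≤ {r = r} (suc N) a b d a≤b qa@(r≤a , _) qb@(_ , b≤1+r)
    | inj₂ (closer {a′} {b′} raise lower ta tb da db) with total a ≤? r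
  ... | yes a≤r = (raise , qa , qa′) ◅ connect N a′ b (suc-injective (trans (sym da) d)) qa′ qb
    where
    qa′ : NarrowTotal r a′
    qa′ = subst (r ≤_) (sym ta) (m≤n⇒m≤1+n r≤a) , subst (_≤ suc r) (sym ta) (s≤s a≤r)
  ... | no  a≰r =
    connect N a b′ (suc-injective (trans (sym db) d)) qa qb′ ◅◅ (lower , qb′ , qb) ◅ ε
    where
    qb′ : NarrowTotal r b′
    qb′ = s≤s⁻¹ (subst (suc r ≤_) tb (≤-trans (≰⇒> a≰r) a≤b)) ,
          ≤-trans (n≤1+n _) (subst (_≤ suc r) tb b≤1+r)

  connect : ∀ {r} N (a b : Vec (Fin l) p) → dist a b ≡ N →
            NarrowTotal r a → NarrowTotal r b → Star (Step (NarrowTotal r)) a b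
  connect N a b d qa qb with ≤-total (total a) (total b)
  ... | inj₁ a≤b = connect-≤ N a b d a≤b qa qb
  ... | inj₂ b≤a = Star.reverse Step-sym (connect-≤ N b a (trans (dist-comm b a) d) b≤a qb qa)

narrow⇒window : ∀ r (c : Vec (Fin l) p) → NarrowTotal r c → Window r (weight (toList (Vec.map suc c)))
narrow⇒window r c (lo , hi) rewrite weight-map-suc c = *-monoˡ-≤ 2 lo , *-monoˡ-≤ 2 hi

window⇒narrow : ∀ r (c : Vec (Fin l) p) → Window r (weight (toList (Vec.map suc c))) → NarrowTotal r c
window⇒narrow r c (lo , hi) rewrite weight-map-suc c = *-cancelʳ-≤ _ _ 2 lo , *-cancelʳ-≤ _ _ 2 hi

window-connected : ∀ {r} (a b : Tuple (suc (suc l)) p) →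
  Window r (weight (toList a)) → Window r (weight (toList b)) →
  Star (Step (Window r ∘ weight ∘ toList)) a b
window-connected {r = r} a b qa qb
  with c , qc , a→c ← eliminate-zeros (window-roomy r) a qa
     | d , qd , b→d ← eliminate-zeros (window-roomy r) b qb =
  a→c ◅◅
  gmap (Vec.map suc) (λ {v} {w} (s , qv , qw) → ~-map suc s , narrow⇒window r v qv , narrow⇒window r w qw)
    (connect {r = r} _ c d refl (window⇒narrow r c qc) (window⇒narrow r d qd)) ◅◅
  Star.reverse Step-sym b→d

-- Balance and strong connectivity

-- The image under `h` of the first filtered list and the second filtered list are duplicate-free
-- with the same members, hence permutations of each other.
length-filter-bijection : {R S : Pred A 0ℓ} (R? : Decidable R) (S? : Decidable S) {xs : List A} →
  Unique xs → (h : A → A) → (∀ {a b} → h a ≡ h b → a ≡ b) →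
  (∀ {a} → a ∈ xs → R a → h a ∈ xs × S (h a)) →
  (∀ {b} → b ∈ xs → S b → ∃[ a ] (a ∈ xs × R a × h a ≡ b)) →
  List.length (filter R? xs) ≡ List.length (filter S? xs)
length-filter-bijection R? S? {xs} xs-unique h h-injective maps onto =
  trans (sym (List.length-map h (filter R? xs)))
    (↭-length (∼bag⇒↭ (unique∧set⇒bag
      (Unique.map⁺ h-injective (Unique.filter⁺ R? xs-unique))
      (Unique.filter⁺ S? xs-unique)
      (mk⇔ image⇒S S⇒image))))
  where
  image⇒S : ∀ {b} → b ∈ List.map h (filter R? xs) → b ∈ filter S? xs
  image⇒S b∈ with a , a∈ , refl ← ∈-map⁻ h b∈ =
    let a∈xs , ra = ∈-filter⁻ R? {xs = xs} a∈
        ha∈xs , sha = maps a∈xs ra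
    in ∈-filter⁺ S? ha∈xs sha

  S⇒image : ∀ {b} → b ∈ filter S? xs → b ∈ List.map h (filter R? xs)
  S⇒image b∈ with b∈xs , sb ← ∈-filter⁻ S? {xs = xs} b∈
    with a , a∈xs , ra , refl ← onto b∈xs sb = ∈-map⁺ h (∈-filter⁺ R? a∈xs ra)

module _ (k r m : ℕ) where
  private
    G = P k (+ r) (+ suc r) m
    P? = pseudoweightIn? {k} {suc m} (+ r) (+ suc r)
  open Digraph G

  edges⇒window : ∀ {e} → e ∈ edges → Window r (weight (toList e))
  edges⇒window {e} e∈ = pseudoweightIn⇒window r e (proj₂ (∈-filter⁻ P? {xs = allTuples k (suc m)} e∈))

  window⇒edges : ∀ {e} → Window r (weight (toList e)) → e ∈ edges
  window⇒edges {e} q = ∈-filter⁺ P? (allTuples-complete e) (window⇒pseudoweightIn r e q)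

  rotate-edge : ∀ e → e ∈ edges ⇔ rotate e ∈ edges
  rotate-edge e = mk⇔
    (λ e∈ → window⇒edges (subst (Window r) (sym (weight-rotate e)) (edges⇒window e∈)))
    (λ e∈ → window⇒edges (subst (Window r) (weight-rotate e) (edges⇒window e∈)))

  open Equivalence

  balanced : Balanced
  balanced {v} _ = length-filter-bijection (λ e → target e ≟ v) (λ e → source e ≟ v)
    unique rotate rotate-injective
    (λ {a} a∈ into → to (rotate-edge a) a∈ , trans (init-rotate a) into)
    (λ {b} b∈ outOf → let a , ra≡b , tail≡ = unrotate b in
      a , from (rotate-edge a) (subst (_∈ edges) (sym ra≡b) b∈) , trans tail≡ outOf , ra≡b)

  vertex-source : ∀ {v} → IsVertex v → ∃[ e ] (e ∈ edges × init e ≡ v)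
  vertex-source (e , e∈ , inj₁ eq) = e , e∈ , eq
  vertex-source (e , e∈ , inj₂ eq) = rotate e , to (rotate-edge e) e∈ , trans (init-rotate e) eq

module _ (l r m : ℕ) where
  open Digraph (P (suc (suc l)) (+ r) (+ suc r) m)

  stronglyConnected : StronglyConnected
  stronglyConnected u-vertex v-vertex =
    let a , a∈ , a-source = vertex-source _ r m u-vertex
        b , b∈ , b-source = vertex-source _ r m v-vertex
    in subst₂ (Star _⟶_) a-source b-source
      -- Each change of an entry expands into a path between the sources of the two edges.
      (kleisliStar {U = _⟶_} init
        (step-path (Window r) {_⟶_} (λ e q → e , window⇒edges _ r m q , refl , refl))
        (window-connected {r = r} a b (edges⇒window _ r m a∈) (edges⇒window _ r m b∈)))

theorem5p8 : (n k : ℕ) → 2 ≤ n → 2 < k → ¬ (2 ∣ k) →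
    (r : ℤ) → + n ℤ.≤ r → r ℤ.< (+ k ℤ.- 1ℤ) ℤ.* + n →
    Digraph.Eulerian (P k r (r ℤ.+ 1ℤ) (n ∸ 1))
-- The bound `+ n ≤ r` excludes negative `r`, and the rewriting turns the upper end `r + 1` into
-- `suc r`.
theorem5p8 n (suc (suc l)) _ (s≤s (s≤s _)) _ (+ r) _ _ rewrite +-comm r 1 =
  stronglyConnected l r (n ∸ 1) , balanced (suc (suc l)) r (n ∸ 1)
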